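{- Let $p$ be an odd prime and $m,r$ positive integers. Then $S_{mp^r-1}\equiv(-1)^{\frac{p-1}{2}}S_{mp^{r-1}-1}\pmod{p^r}$.
   Context: $(S_n)_{n\ge0}$ is the integer sequence defined by $S_0=1$, $S_1=4$ and $(n+1)^2S_{n+1}=4(3n^2+3n+1)S_n-32n^2S_{n-1}$ for $n\ge1$; equivalently $S_n=\sum_{k=0}^n\binom nk\binom{2k}k\binom{2n-2k}{n-k}$. -}

module Defs where

open import Data.Nat.Base as ℕ using (ℕ)
open import Data.Integer.Base using (ℤ; +_; _*_; _-_)
open import Data.Integer.Divisibility.Signed using (_∣_)
open import Relation.Binary.PropositionalEquality.Core using (_≡_)

infix 4 _≡_[mod_]

_≡_[mod_] : ℤ → ℤ → ℕ → Set
a ≡ b [mod m ] = + m ∣ a - b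

-- These equations determine the sequence uniquely, since (n + 1)² ≠ 0. Only
-- integrality is not automatic: the integers ∑ₖ C(n,k) C(2k,k) C(2n−2k,n−k)
-- satisfy them.
-- In `recurrence`, n ∸ 1 is the true n − 1 because 1 ≤ n.
record IsS (S : ℕ → ℤ) : Set where
  field
    S₀ : S 0 ≡ + 1
    S₁ : S 1 ≡ + 4
    recurrence : ∀ n → 1 ℕ.≤ n →
      + ((n ℕ.+ 1) ℕ.^ 2) * S (n ℕ.+ 1)
        ≡ + (4 ℕ.* (3 ℕ.* n ℕ.^ 2 ℕ.+ 3 ℕ.* n ℕ.+ 1)) * S n
          - + (32 ℕ.* n ℕ.^ 2) * S (n ℕ.∸ 1)

{-# OPTIONS --safe #-}

-- Write B k = C(2k,k) and t k j = C(k+j,k) B(k) B(j), so that S n = ∑_{k+j=n} t k j; since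
-- (k+1)² t (k+1) j = 2 (2k+1) (k+j+1) t k j, this follows by comparing the moments ∑ kⁱ t k j (i ≤ 3)
-- using the symmetry of t.
--
-- Let pʳ ∣ n and k + j = n - 1. The super Catalan numbers A k j = B k B j / C(k+j,k) are integers with
-- n A (k+1) j = 2 (2k+1) A k j, hence n ∣ 2 (2k+1) B(k) B(j). So t k j ≡ 0 (mod pʳ) unless p ∣ 2k + 1,
-- that is, k = h + a p and j = h + b p with p = 2h + 1.
-- For such k and j let F i be the product of the numbers up to i that are prime to p. Then
-- C(k+j,k) / C(a+b,a) = F(k+j) / (F k F j), and pairing i with k + j + 1 - i shows that this is (-1)ʰ
-- modulo k + j + 1. The same holds for B(k) modulo 2k + 1 and B(j) modulo 2j + 1. These moduli may be
-- divisible by lower powers of p than pʳ, but (2k+1) t a b and (2j+1) t a b are divisible by pʳ,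
-- and so t k j ≡ (-1)³ʰ t a b (mod pʳ).
module Submission where

open import Defs
open import Data.Nat.Base as ℕ using (ℕ; zero; suc; _!)
open import Data.Nat.Combinatorics using (_C_; nCk≡n!/k![n-k]!; nCk≡nC[n∸k]; k![n∸k]!∣n!; nCn≡1)
open import Data.Nat.DivMod as ℕ using (_/_; _%_)
open import Data.Nat.Divisibility as ℕ using ()
open import Data.Nat.Primality using (Prime; euclidsLemma; ¬prime[1])
open import Data.Nat.Properties as ℕ using ()
open import Data.Nat.Tactic.RingSolver as ℕ using ()
open import Data.Integer.Base using (ℤ; +_; 0ℤ; 1ℤ; -1ℤ; _+_; _*_; _-_; -_; _^_; ∣_∣; NonZero)
open import Data.Integer.Divisibility.Signed as ℤ using (_∣_; divides)
open import Data.Integer.Properties as ℤ using ()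
open import Algebra.Properties.CommutativeSemigroup ℤ.*-commutativeSemigroup using (x∙yz≈y∙xz)
open import Data.Integer.Tactic.RingSolver using (solve-∀)
open import Data.Product.Base using (_×_; _,_; proj₁)
open import Data.Sum.Base using (inj₁; inj₂)
open import Relation.Binary.PropositionalEquality
open import Relation.Nullary.Decidable.Core using (yes; no)
open import Relation.Nullary.Negation.Core using (¬_; contradiction)

-- Sums over an antidiagonal

-- D f n = ∑_{k+j=n} f k j.
D : (ℕ → ℕ → ℤ) → ℕ → ℤ
D f zero    = f 0 0
D f (suc n) = f 0 (suc n) + D (λ k → f (suc k)) n

D-cong : ∀ {f g} n → (∀ k j → k ℕ.+ j ≡ n → f k j ≡ g k j) → D f n ≡ D g n
D-cong zero    e = e 0 0 refl
D-cong (suc n) e = cong₂ _+_ (e 0 (suc n) refl)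
  (D-cong n λ k j k+j≡n → e (suc k) j (cong suc k+j≡n))

-- The shape "one scaled summand plus a rest" can be iterated: it splits a linear combination of any
-- length, with `D-scale` for the last summand.
D-linear : ∀ x f g n → D (λ k j → x * f k j + g k j) n ≡ x * D f n + D g n
D-linear x f g zero    = refl
D-linear x f g (suc n) = trans
  (cong (λ z → x * f 0 (suc n) + g 0 (suc n) + z)
        (D-linear x (λ k → f (suc k)) (λ k → g (suc k)) n))
  (rearrange x (f 0 (suc n)) (g 0 (suc n)) _ _)
  where
  rearrange : ∀ x a b c d → x * a + b + (x * c + d) ≡ x * (a + c) + (b + d)
  rearrange = solve-∀

D-scale : ∀ x f n → D (λ k j → x * f k j) n ≡ x * D f n
D-scale x f zero    = refl
D-scale x f (suc n) = trans (cong (λ z → x * f 0 (suc n) + z) (D-scale x (λ k → f (suc k)) n))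
  (sym (ℤ.*-distribˡ-+ x (f 0 (suc n)) _))

D-snoc : ∀ f n → D f (suc n) ≡ D (λ k j → f k (suc j)) n + f (suc n) 0
D-snoc f zero    = refl
D-snoc f (suc n) = trans (cong (λ z → f 0 (suc (suc n)) + z) (D-snoc (λ k → f (suc k)) n))
  (sym (ℤ.+-assoc (f 0 (suc (suc n))) _ _))

D-flip : ∀ f n → D f n ≡ D (λ k j → f j k) n
D-flip f zero    = refl
D-flip f (suc n) = begin
  f 0 (suc n) + D (λ k → f (suc k)) n         ≡⟨ cong (λ z → f 0 (suc n) + z) (D-flip (λ k → f (suc k)) n) ⟩
  f 0 (suc n) + D (λ k j → f (suc j) k) n     ≡⟨ ℤ.+-comm (f 0 (suc n)) _ ⟩
  D (λ k j → f (suc j) k) n + f 0 (suc n)     ≡⟨ D-snoc (λ k j → f j k) n ⟨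
  D (λ k j → f j k) (suc n)                   ∎
  where open ≡-Reasoning

-- Binomial coefficients indexed by the two parts of the upper entry

c : ℕ → ℕ → ℤ
c a b = + ((a ℕ.+ b) C a)

c-sym : ∀ a b → c a b ≡ c b a
c-sym a b = cong +_ (begin
  (a ℕ.+ b) C a               ≡⟨ nCk≡nC[n∸k] (ℕ.m≤m+n a b) ⟩
  (a ℕ.+ b) C (a ℕ.+ b ℕ.∸ a) ≡⟨ cong₂ _C_ (ℕ.+-comm a b) (ℕ.m+n∸m≡n a b) ⟩
  (b ℕ.+ a) C b               ∎)
  where open ≡-Reasoning

c-factorial : ∀ a b → c a b * + (a ! ℕ.* b !) ≡ + ((a ℕ.+ b) !)
c-factorial a b = trans (sym (ℤ.pos-* ((a ℕ.+ b) C a) (a ! ℕ.* b !))) (cong +_ (begin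
  ((a ℕ.+ b) C a) ℕ.* (a ! ℕ.* b !)            ≡⟨ cong (λ z → ((a ℕ.+ b) C a) ℕ.* (a ! ℕ.* z !)) (ℕ.m+n∸m≡n a b) ⟨
  ((a ℕ.+ b) C a) ℕ.* d                        ≡⟨ cong (ℕ._* d) (nCk≡n!/k![n-k]! (ℕ.m≤m+n a b)) ⟩
  ((a ℕ.+ b) ! / d) ℕ.* d                    ≡⟨ ℕ.m/n*n≡m (k![n∸k]!∣n! (ℕ.m≤m+n a b)) ⟩
  (a ℕ.+ b) !                                ∎))
  where
  open ≡-Reasoning
  d = a ! ℕ.* (a ℕ.+ b ℕ.∸ a) !
  instance d≢0 = a ℕ.!* (a ℕ.+ b ℕ.∸ a) !≢0

-- Multiplied by the nonzero number a! b!, both sides become (a+b+1)!.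
c-sucˡ : ∀ a b → + suc a * c (suc a) b ≡ + suc (a ℕ.+ b) * c a b
c-sucˡ a b = ℤ.*-cancelʳ-≡ _ _ (+ (a ! ℕ.* b !)) (begin
  + suc a * c (suc a) b * + (a ! ℕ.* b !)       ≡⟨ cong (λ z → + suc a * c (suc a) b * z) (ℤ.pos-* (a !) (b !)) ⟩
  + suc a * c (suc a) b * (+ (a !) * + (b !))   ≡⟨ rearrange (+ suc a) (c (suc a) b) (+ (a !)) (+ (b !)) ⟩
  c (suc a) b * (+ suc a * + (a !) * + (b !))   ≡⟨ cong (λ z → c (suc a) b * (z * + (b !))) (ℤ.pos-* (suc a) (a !)) ⟨
  c (suc a) b * (+ (suc a !) * + (b !))         ≡⟨ cong (c (suc a) b *_) (ℤ.pos-* (suc a !) (b !)) ⟨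
  c (suc a) b * + (suc a ! ℕ.* b !)             ≡⟨ c-factorial (suc a) b ⟩
  + ((suc a ℕ.+ b) !)                           ≡⟨ ℤ.pos-* (suc (a ℕ.+ b)) ((a ℕ.+ b) !) ⟩
  + suc (a ℕ.+ b) * + ((a ℕ.+ b) !)             ≡⟨ cong (+ suc (a ℕ.+ b) *_) (c-factorial a b) ⟨
  + suc (a ℕ.+ b) * (c a b * + (a ! ℕ.* b !))   ≡⟨ ℤ.*-assoc (+ suc (a ℕ.+ b)) (c a b) _ ⟨
  + suc (a ℕ.+ b) * c a b * + (a ! ℕ.* b !)     ∎)
  where
  open ≡-Reasoning
  instance nz = a ℕ.!* b !≢0
  rearrange : ∀ s x u v → s * x * (u * v) ≡ x * (s * u * v)
  rearrange = solve-∀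

c-sucʳ : ∀ a b → + suc b * c a (suc b) ≡ + suc (a ℕ.+ b) * c a b
c-sucʳ a b = begin
  + suc b * c a (suc b)       ≡⟨ cong (+ suc b *_) (c-sym a (suc b)) ⟩
  + suc b * c (suc b) a       ≡⟨ c-sucˡ b a ⟩
  + suc (b ℕ.+ a) * c b a     ≡⟨ cong₂ _*_ (cong (λ z → + suc z) (ℕ.+-comm b a)) (c-sym b a) ⟩
  + suc (a ℕ.+ b) * c a b     ∎
  where open ≡-Reasoning

B : ℕ → ℤ
B k = c k k

B-suc : ∀ k → + suc k * B (suc k) ≡ + 2 * (+ 2 * + k + 1ℤ) * B k
-- A second factor `suc k` lets the two indices be raised one at a time. The factor 2k + 2 that
-- arises is twice `suc k`, which then cancels.
B-suc k = ℤ.*-cancelˡ-≡ (+ suc k) _ _ (begin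
  + suc k * (+ suc k * c (suc k) (suc k))                ≡⟨ cong (+ suc k *_) (c-sucˡ k (suc k)) ⟩
  + suc k * (+ suc (k ℕ.+ suc k) * c k (suc k))          ≡⟨ x∙yz≈y∙xz (+ suc k) (+ suc (k ℕ.+ suc k)) (c k (suc k)) ⟩
  + suc (k ℕ.+ suc k) * (+ suc k * c k (suc k))          ≡⟨ cong (+ suc (k ℕ.+ suc k) *_) (c-sucʳ k k) ⟩
  + suc (k ℕ.+ suc k) * (+ suc (k ℕ.+ k) * c k k)        ≡⟨⟩
  (1ℤ + (+ k + (1ℤ + + k))) * ((1ℤ + (+ k + + k)) * c k k) ≡⟨ factor (+ k) (c k k) ⟩
  (1ℤ + + k) * (+ 2 * (+ 2 * + k + 1ℤ) * B k)            ∎)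
  where
  open ≡-Reasoning
  factor : ∀ k x → (1ℤ + (k + (1ℤ + k))) * ((1ℤ + (k + k)) * x) ≡ (1ℤ + k) * (+ 2 * (+ 2 * k + 1ℤ) * x)
  factor = solve-∀

-- Moments of `t` and the recurrence for their sum

t : ℕ → ℕ → ℤ
t k j = c k j * B k * B j

t-sym : ∀ k j → t k j ≡ t j k
t-sym k j = trans (cong (λ z → z * B k * B j) (c-sym k j)) (swap (c j k) (B k) (B j))
  where
  swap : ∀ x y z → x * y * z ≡ x * z * y
  swap = solve-∀

-- One factor `suc k` is absorbed by the binomial coefficient `c`, the other by `B`.
t-sucˡ : ∀ k j → + suc k * + suc k * t (suc k) j
                ≡ + 2 * (+ 2 * + k + 1ℤ) * + suc (k ℕ.+ j) * t k j
t-sucˡ k j = begin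
  + suc k * + suc k * (c (suc k) j * B (suc k) * B j)             ≡⟨ group (+ suc k) (c (suc k) j) (B (suc k)) (B j) ⟩
  (+ suc k * c (suc k) j) * (+ suc k * B (suc k)) * B j           ≡⟨ cong₂ (λ x y → x * y * B j) (c-sucˡ k j) (B-suc k) ⟩
  (+ suc (k ℕ.+ j) * c k j) * (+ 2 * (+ 2 * + k + 1ℤ) * B k) * B j ≡⟨ regroup (+ suc (k ℕ.+ j)) (c k j) (+ k) (B k) (B j) ⟩
  + 2 * (+ 2 * + k + 1ℤ) * + suc (k ℕ.+ j) * t k j ∎
  where
  open ≡-Reasoning
  group : ∀ s x y z → s * s * (x * y * z) ≡ (s * x) * (s * y) * z
  group = solve-∀
  regroup : ∀ n x k y z → n * x * (+ 2 * (+ 2 * k + 1ℤ) * y) * z ≡ + 2 * (+ 2 * k + 1ℤ) * n * (x * y * z)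
  regroup = solve-∀

moment : (ℤ → ℤ) → ℕ → ℤ
moment q = D (λ k j → q (+ k) * t k j)

m₀ m₁ m₂ m₃ : ℕ → ℤ
m₀ = D t
m₁ = moment (λ k → k)
m₂ = moment (λ k → k * k)
m₃ = moment (λ k → k * k * k)


-- By symmetry of `t`, exchanging k with j = n - k turns `m₁ n` into n m₀ - m₁.
2*m₁ : ∀ n → + 2 * m₁ n ≡ + n * m₀ n
2*m₁ n = begin
  + 2 * m₁ n                      ≡⟨ double (m₁ n) ⟩
  m₁ n + m₁ n                     ≡⟨ cong (λ z → m₁ n + z) reflected ⟩
  m₁ n + (-1ℤ * m₁ n + + n * m₀ n) ≡⟨ cancel (m₁ n) (+ n * m₀ n) ⟩
  + n * m₀ n                      ∎
  where
  open ≡-Reasoning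
  double : ∀ x → + 2 * x ≡ x + x
  double = solve-∀
  cancel : ∀ x y → x + (-1ℤ * x + y) ≡ y
  cancel = solve-∀
  pointwise : ∀ k j x → j * x ≡ -1ℤ * (k * x) + (k + j) * x
  pointwise = solve-∀
  reflected : m₁ n ≡ -1ℤ * m₁ n + + n * m₀ n
  reflected = begin
    m₁ n
      ≡⟨ D-flip _ n ⟩
    D (λ k j → + j * t j k) n
      ≡⟨ D-cong n (λ { k j refl → trans (cong (+ j *_) (t-sym j k)) (pointwise (+ k) (+ j) (t k j)) }) ⟩
    D (λ k j → -1ℤ * (+ k * t k j) + + n * t k j) n
      ≡⟨ D-linear -1ℤ _ _ n ⟩
    -1ℤ * m₁ n + D (λ k j → + n * t k j) n
      ≡⟨ cong (λ z → -1ℤ * m₁ n + z) (D-scale (+ n) t n) ⟩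
    -1ℤ * m₁ n + + n * m₀ n ∎

-- The same reflection, applied to (n - k)³, gives 2 m₃ in terms of the lower moments. Another
-- factor 2 is needed because only `+ 2 * m₁ n` is known through `m₀`.
4*m₃ : ∀ n → + 4 * m₃ n ≡ + 6 * + n * m₂ n - + n * + n * + n * m₀ n
4*m₃ n = begin
  + 4 * m₃ n
    ≡⟨ double (m₃ n) ⟩
  + 2 * m₃ n + + 2 * m₃ n
    ≡⟨ cong (λ z → + 2 * m₃ n + + 2 * z) reflected ⟩
  + 2 * m₃ n + + 2 * (-1ℤ * m₃ n + (+ 3 * + n * m₂ n + (- (+ 3 * + n * + n) * m₁ n + + n * + n * + n * m₀ n)))
    ≡⟨ cancel (+ n) (m₀ n) (m₁ n) (m₂ n) (m₃ n) ⟩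
  + 6 * + n * m₂ n - + 3 * + n * + n * (+ 2 * m₁ n) + + 2 * (+ n * + n * + n * m₀ n)
    ≡⟨ cong (λ z → + 6 * + n * m₂ n - + 3 * + n * + n * z + + 2 * (+ n * + n * + n * m₀ n)) (2*m₁ n) ⟩
  + 6 * + n * m₂ n - + 3 * + n * + n * (+ n * m₀ n) + + 2 * (+ n * + n * + n * m₀ n)
    ≡⟨ collect (+ n) (m₀ n) (m₂ n) ⟩
  + 6 * + n * m₂ n - + n * + n * + n * m₀ n ∎
  where
  open ≡-Reasoning
  double : ∀ x → + 4 * x ≡ + 2 * x + + 2 * x
  double = solve-∀
  cancel : ∀ n a b c d → + 2 * d + + 2 * (-1ℤ * d + (+ 3 * n * c + (- (+ 3 * n * n) * b + n * n * n * a)))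
    ≡ + 6 * n * c - + 3 * n * n * (+ 2 * b) + + 2 * (n * n * n * a)
  cancel = solve-∀
  collect : ∀ n a c → + 6 * n * c - + 3 * n * n * (n * a) + + 2 * (n * n * n * a) ≡ + 6 * n * c - n * n * n * a
  collect = solve-∀
  pointwise : ∀ k j x → j * j * j * x ≡ -1ℤ * (k * k * k * x) + (+ 3 * (k + j) * (k * k * x)
    + (- (+ 3 * (k + j) * (k + j)) * (k * x) + (k + j) * (k + j) * (k + j) * x))
  pointwise = solve-∀
  reflected : m₃ n ≡ -1ℤ * m₃ n + (+ 3 * + n * m₂ n + (- (+ 3 * + n * + n) * m₁ n + + n * + n * + n * m₀ n))
  reflected = begin
    m₃ n
      ≡⟨ D-flip _ n ⟩
    D (λ k j → + j * + j * + j * t j k) n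
      ≡⟨ D-cong n (λ { k j refl → trans (cong (+ j * + j * + j *_) (t-sym j k)) (pointwise (+ k) (+ j) (t k j)) }) ⟩
    D (λ k j → -1ℤ * (+ k * + k * + k * t k j) + (+ 3 * + n * (+ k * + k * t k j)
        + (- (+ 3 * + n * + n) * (+ k * t k j) + + n * + n * + n * t k j))) n
      ≡⟨ D-linear -1ℤ _ _ n ⟩
    -1ℤ * m₃ n + D (λ k j → + 3 * + n * (+ k * + k * t k j)
        + (- (+ 3 * + n * + n) * (+ k * t k j) + + n * + n * + n * t k j)) n
      ≡⟨ cong (λ z → -1ℤ * m₃ n + z) (trans (D-linear (+ 3 * + n) _ _ n)
           (cong (λ z → + 3 * + n * m₂ n + z) (trans (D-linear (- (+ 3 * + n * + n)) _ _ n)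
             (cong (λ z → - (+ 3 * + n * + n) * m₁ n + z) (D-scale (+ n * + n * + n) t n))))) ⟩
    -1ℤ * m₃ n + (+ 3 * + n * m₂ n + (- (+ 3 * + n * + n) * m₁ n + + n * + n * + n * m₀ n)) ∎

-- The term k = 0 vanishes. In the others `t-sucˡ` uses up k², leaving a weight linear in k;
-- symmetry then removes `m₁`.
m₂-suc : ∀ n → m₂ (suc n) ≡ + 2 * + suc n * + suc n * m₀ n
m₂-suc n = begin
  0ℤ * 0ℤ * t 0 (suc n) + D (λ k j → + suc k * + suc k * t (suc k) j) n
    ≡⟨ cong₂ _+_ (drop (t 0 (suc n))) (D-cong n (λ { k j refl → trans (t-sucˡ k j) (expand (+ k) (+ suc n) (t k j)) })) ⟩
  0ℤ + D (λ k j → + 4 * + suc n * (+ k * t k j) + + 2 * + suc n * t k j) n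
    ≡⟨ ℤ.+-identityˡ _ ⟩
  D (λ k j → + 4 * + suc n * (+ k * t k j) + + 2 * + suc n * t k j) n
    ≡⟨ D-linear (+ 4 * + suc n) _ _ n ⟩
  + 4 * + suc n * m₁ n + D (λ k j → + 2 * + suc n * t k j) n
    ≡⟨ cong (λ z → + 4 * + suc n * m₁ n + z) (D-scale (+ 2 * + suc n) t n) ⟩
  + 4 * + suc n * m₁ n + + 2 * + suc n * m₀ n
    ≡⟨ group (+ suc n) (m₁ n) (m₀ n) ⟩
  + 2 * + suc n * (+ 2 * m₁ n + m₀ n)
    ≡⟨ cong (λ z → + 2 * + suc n * (z + m₀ n)) (2*m₁ n) ⟩
  + 2 * + suc n * (+ n * m₀ n + m₀ n)
    ≡⟨ collect (+ n) (m₀ n) ⟩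
  + 2 * + suc n * + suc n * m₀ n ∎
  where
  open ≡-Reasoning
  drop : ∀ x → 0ℤ * 0ℤ * x ≡ 0ℤ
  drop = solve-∀
  expand : ∀ k n x → + 2 * (+ 2 * k + 1ℤ) * n * x ≡ + 4 * n * (k * x) + + 2 * n * x
  expand = solve-∀
  group : ∀ n a b → + 4 * n * a + + 2 * n * b ≡ + 2 * n * (+ 2 * a + b)
  group = solve-∀
  collect : ∀ n a → + 2 * (1ℤ + n) * (n * a + a) ≡ + 2 * (1ℤ + n) * (1ℤ + n) * a
  collect = solve-∀

-- As for `m₂-suc`, except that one factor `suc k` survives and the remaining weight is quadratic.
m₃-suc : ∀ n → m₃ (suc n) ≡ + suc n * (+ 4 * m₂ n + + 6 * m₁ n + + 2 * m₀ n)
m₃-suc n = begin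
  0ℤ * 0ℤ * 0ℤ * t 0 (suc n) + D (λ k j → + suc k * + suc k * + suc k * t (suc k) j) n
    ≡⟨ cong₂ _+_ (drop (t 0 (suc n))) (D-cong n (λ { k j refl → trans (assoc (+ suc k) (t (suc k) j))
         (trans (cong (+ suc k *_) (t-sucˡ k j)) (expand (+ k) (+ suc n) (t k j))) })) ⟩
  0ℤ + D (λ k j → + 4 * + suc n * (+ k * + k * t k j) + (+ 6 * + suc n * (+ k * t k j) + + 2 * + suc n * t k j)) n
    ≡⟨ ℤ.+-identityˡ _ ⟩
  D (λ k j → + 4 * + suc n * (+ k * + k * t k j) + (+ 6 * + suc n * (+ k * t k j) + + 2 * + suc n * t k j)) n
    ≡⟨ trans (D-linear (+ 4 * + suc n) _ _ n) (cong (λ z → + 4 * + suc n * m₂ n + z)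
         (trans (D-linear (+ 6 * + suc n) _ _ n) (cong (λ z → + 6 * + suc n * m₁ n + z) (D-scale (+ 2 * + suc n) t n)))) ⟩
  + 4 * + suc n * m₂ n + (+ 6 * + suc n * m₁ n + + 2 * + suc n * m₀ n)
    ≡⟨ group (+ suc n) (m₂ n) (m₁ n) (m₀ n) ⟩
  + suc n * (+ 4 * m₂ n + + 6 * m₁ n + + 2 * m₀ n) ∎
  where
  open ≡-Reasoning
  drop : ∀ x → 0ℤ * 0ℤ * 0ℤ * x ≡ 0ℤ
  drop = solve-∀
  assoc : ∀ k x → k * k * k * x ≡ k * (k * k * x)
  assoc = solve-∀
  expand : ∀ k n x → (1ℤ + k) * (+ 2 * (+ 2 * k + 1ℤ) * n * x)
    ≡ + 4 * n * (k * k * x) + (+ 6 * n * (k * x) + + 2 * n * x)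
  expand = solve-∀
  group : ∀ n a b c → + 4 * n * a + (+ 6 * n * b + + 2 * n * c) ≡ n * (+ 4 * a + + 6 * b + + 2 * c)
  group = solve-∀

-- The third moment at N is computed twice: by reflection (`4*m₃`) and by lowering k (`m₃-suc`).
-- Equating the two results and eliminating `m₂` and `m₁` leaves only values of `m₀`, with a common
-- factor N.
m₀-recurrence : ∀ l → let n = suc l; N = suc n in
  + N * + N * m₀ N ≡ + 4 * (+ 3 * + n * + n + + 3 * + n + 1ℤ) * m₀ n - + 32 * + n * + n * m₀ l
m₀-recurrence l = ℤ.*-cancelˡ-≡ (+ N) _ _ (begin
  + N * (+ N * + N * m₀ N)
    ≡⟨ solve-for (+ N) (m₀ N) (m₂ N) ⟩
  + 6 * + N * m₂ N - (+ 6 * + N * m₂ N - + N * + N * + N * m₀ N)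
    ≡⟨ cong₂ (λ x y → + 6 * + N * x - y) (m₂-suc n) (trans (sym (4*m₃ N)) (cong (+ 4 *_) (m₃-suc n))) ⟩
  + 6 * + N * (+ 2 * + N * + N * m₀ n) - + 4 * (+ N * (+ 4 * m₂ n + + 6 * m₁ n + + 2 * m₀ n))
    ≡⟨ expose (+ N) (m₀ n) (m₁ n) (m₂ n) ⟩
  + N * (+ 12 * + N * + N * m₀ n - (+ 16 * m₂ n + + 12 * (+ 2 * m₁ n) + + 8 * m₀ n))
    ≡⟨ cong₂ (λ x y → + N * (+ 12 * + N * + N * m₀ n - (+ 16 * x + + 12 * y + + 8 * m₀ n))) (m₂-suc l) (2*m₁ n) ⟩
  + N * (+ 12 * + N * + N * m₀ n - (+ 16 * (+ 2 * + n * + n * m₀ l) + + 12 * (+ n * m₀ n) + + 8 * m₀ n))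
    ≡⟨ cong (+ N *_) (collect (+ n) (m₀ n) (m₀ l)) ⟩
  + N * (+ 4 * (+ 3 * + n * + n + + 3 * + n + 1ℤ) * m₀ n - + 32 * + n * + n * m₀ l) ∎)
  where
  open ≡-Reasoning
  n = suc l
  N = suc n
  solve-for : ∀ N a c → N * (N * N * a) ≡ + 6 * N * c - (+ 6 * N * c - N * N * N * a)
  solve-for = solve-∀
  expose : ∀ N a b c → + 6 * N * (+ 2 * N * N * a) - + 4 * (N * (+ 4 * c + + 6 * b + + 2 * a))
    ≡ N * (+ 12 * N * N * a - (+ 16 * c + + 12 * (+ 2 * b) + + 8 * a))
  expose = solve-∀
  collect : ∀ n a z → + 12 * (1ℤ + n) * (1ℤ + n) * a - (+ 16 * (+ 2 * n * n * z) + + 12 * (n * a) + + 8 * a)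
    ≡ + 4 * (+ 3 * n * n + + 3 * n + 1ℤ) * a - + 32 * n * n * z
  collect = solve-∀

pos-² : ∀ x → + (x ℕ.^ 2) ≡ + x * + x
pos-² x = trans (cong (λ z → + (x ℕ.* z)) (ℕ.*-identityʳ x)) (ℤ.pos-* x x)

S≡m₀ : ∀ {S} → IsS S → ∀ n → S n ≡ m₀ n
S≡m₀ {S} isS i = proj₁ (consecutive i)
  where
  open IsS isS
  open ≡-Reasoning
  coefficient : ∀ n → + (4 ℕ.* (3 ℕ.* n ℕ.^ 2 ℕ.+ 3 ℕ.* n ℕ.+ 1)) ≡ + 4 * (+ 3 * + n * + n + + 3 * + n + 1ℤ)
  coefficient n = begin
    + (4 ℕ.* (3 ℕ.* n ℕ.^ 2 ℕ.+ 3 ℕ.* n ℕ.+ 1))    ≡⟨ ℤ.pos-* 4 (3 ℕ.* n ℕ.^ 2 ℕ.+ 3 ℕ.* n ℕ.+ 1) ⟩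
    + 4 * (+ (3 ℕ.* n ℕ.^ 2) + + (3 ℕ.* n) + 1ℤ)    ≡⟨ cong₂ (λ x y → + 4 * (x + y + 1ℤ)) (trans (ℤ.pos-* 3 (n ℕ.^ 2)) (trans (cong (+ 3 *_) (pos-² n)) (sym (ℤ.*-assoc (+ 3) (+ n) (+ n))))) (ℤ.pos-* 3 n) ⟩
    + 4 * (+ 3 * + n * + n + + 3 * + n + 1ℤ)        ∎

  -- The recurrence has order two, so the induction carries two neighbouring values. In the base
  -- case `m₀ 0` and `m₀ 1` compute to 1 and 4.
  consecutive : ∀ n → S n ≡ m₀ n × S (suc n) ≡ m₀ (suc n)
  consecutive zero    = S₀ , S₁
  consecutive (suc l) with Sₗ , Sₙ ← consecutive l = Sₙ , ℤ.*-cancelˡ-≡ (+ N * + N) _ _ (begin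
    + N * + N * S N
      ≡⟨ cong₂ _*_ (trans (cong (λ z → + (z ℕ.^ 2)) (ℕ.+-comm n 1)) (pos-² N)) (cong S (ℕ.+-comm n 1)) ⟨
    + ((n ℕ.+ 1) ℕ.^ 2) * S (n ℕ.+ 1)
      ≡⟨ recurrence n (ℕ.s≤s ℕ.z≤n) ⟩
    + (4 ℕ.* (3 ℕ.* n ℕ.^ 2 ℕ.+ 3 ℕ.* n ℕ.+ 1)) * S n - + (32 ℕ.* n ℕ.^ 2) * S l
      ≡⟨ cong₂ _-_ (cong₂ _*_ (coefficient n) Sₙ)
           (cong₂ _*_ (trans (ℤ.pos-* 32 (n ℕ.^ 2)) (trans (cong (+ 32 *_) (pos-² n)) (sym (ℤ.*-assoc (+ 32) (+ n) (+ n))))) Sₗ) ⟩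
    + 4 * (+ 3 * + n * + n + + 3 * + n + 1ℤ) * m₀ n - + 32 * + n * + n * m₀ l
      ≡⟨ m₀-recurrence l ⟨
    + N * + N * m₀ N ∎)
    where
    n = suc l
    N = suc n

-- Super Catalan numbers

-- A k j = (2k)! (2j)! / (k! j! (k+j)!); this recursion makes the integrality evident.
A : ℕ → ℕ → ℤ
A k zero    = B k
A k (suc j) = + 4 * A k j - A (suc k) j

-- Proved together with `A-sucʳ` by induction on j. The second follows from the first and the
-- recursion of `A`, since 4(k+j+1) - 2(2k+1) = 2(2j+1).
A-sucˡ : ∀ k j → + suc (k ℕ.+ j) * A (suc k) j ≡ + 2 * (+ 2 * + k + 1ℤ) * A k j
A-sucʳ : ∀ k j → + suc (k ℕ.+ j) * A k (suc j) ≡ + 2 * (+ 2 * + j + 1ℤ) * A k j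

A-sucˡ k zero    = trans (cong (λ z → + suc z * B (suc k)) (ℕ.+-identityʳ k)) (B-suc k)
-- The factor n = k + j + 1 pays for lowering `suc j` to j, by `A-sucʳ`; the claim is known there,
-- and `A-sucʳ` leads back.
A-sucˡ k (suc j) = ℤ.*-cancelˡ-≡ (+ n) _ _ (begin
  + n * (+ suc (k ℕ.+ suc j) * A (suc k) (suc j))         ≡⟨ cong (λ z → + n * (+ suc z * A (suc k) (suc j))) (ℕ.+-suc k j) ⟩
  + n * (+ suc n * A (suc k) (suc j))                     ≡⟨ cong (+ n *_) (A-sucʳ (suc k) j) ⟩
  + n * (+ 2 * (+ 2 * + j + 1ℤ) * A (suc k) j)            ≡⟨ x∙yz≈y∙xz (+ n) (+ 2 * (+ 2 * + j + 1ℤ)) (A (suc k) j) ⟩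
  + 2 * (+ 2 * + j + 1ℤ) * (+ n * A (suc k) j)            ≡⟨ cong (+ 2 * (+ 2 * + j + 1ℤ) *_) (A-sucˡ k j) ⟩
  + 2 * (+ 2 * + j + 1ℤ) * (+ 2 * (+ 2 * + k + 1ℤ) * A k j) ≡⟨ x∙yz≈y∙xz (+ 2 * (+ 2 * + j + 1ℤ)) (+ 2 * (+ 2 * + k + 1ℤ)) (A k j) ⟩
  + 2 * (+ 2 * + k + 1ℤ) * (+ 2 * (+ 2 * + j + 1ℤ) * A k j) ≡⟨ cong (+ 2 * (+ 2 * + k + 1ℤ) *_) (A-sucʳ k j) ⟨
  + 2 * (+ 2 * + k + 1ℤ) * (+ n * A k (suc j))            ≡⟨ x∙yz≈y∙xz (+ 2 * (+ 2 * + k + 1ℤ)) (+ n) (A k (suc j)) ⟩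
  + n * (+ 2 * (+ 2 * + k + 1ℤ) * A k (suc j))            ∎)
  where
  open ≡-Reasoning
  n = suc (k ℕ.+ j)

A-sucʳ k j = begin
  + suc (k ℕ.+ j) * (+ 4 * A k j - A (suc k) j)                             ≡⟨ expand (+ suc (k ℕ.+ j)) (A k j) (A (suc k) j) ⟩
  + 4 * + suc (k ℕ.+ j) * A k j - + suc (k ℕ.+ j) * A (suc k) j             ≡⟨ cong (λ z → + 4 * + suc (k ℕ.+ j) * A k j - z) (A-sucˡ k j) ⟩
  + 4 * + suc (k ℕ.+ j) * A k j - + 2 * (+ 2 * + k + 1ℤ) * A k j            ≡⟨ collect (+ k) (+ j) (A k j) ⟩
  + 2 * (+ 2 * + j + 1ℤ) * A k j                                            ∎
  where
  open ≡-Reasoning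
  expand : ∀ n x y → n * (+ 4 * x - y) ≡ + 4 * n * x - n * y
  expand = solve-∀
  collect : ∀ k j x → + 4 * (1ℤ + (k + j)) * x - + 2 * (+ 2 * k + 1ℤ) * x ≡ + 2 * (+ 2 * j + 1ℤ) * x
  collect = solve-∀

-- When j is raised, both sides gain the factor 2(2j+1)/(j+1). On the right it is the product of
-- (k+j+1)/(j+1) from `c` and 2(2j+1)/(k+j+1) from `A`.
B*B≡c*A : ∀ k j → B k * B j ≡ c k j * A k j
B*B≡c*A k zero    = trans (ℤ.*-comm (B k) 1ℤ)
  (cong (λ z → + z * B k) (sym (trans (cong (_C k) (ℕ.+-identityʳ k)) (nCn≡1 k))))
B*B≡c*A k (suc j) = ℤ.*-cancelˡ-≡ (+ suc j) _ _ (begin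
  + suc j * (B k * B (suc j))               ≡⟨ x∙yz≈y∙xz (+ suc j) (B k) (B (suc j)) ⟩
  B k * (+ suc j * B (suc j))               ≡⟨ cong (B k *_) (B-suc j) ⟩
  B k * (+ 2 * (+ 2 * + j + 1ℤ) * B j)      ≡⟨ x∙yz≈y∙xz (B k) (+ 2 * (+ 2 * + j + 1ℤ)) (B j) ⟩
  + 2 * (+ 2 * + j + 1ℤ) * (B k * B j)      ≡⟨ cong (+ 2 * (+ 2 * + j + 1ℤ) *_) (B*B≡c*A k j) ⟩
  + 2 * (+ 2 * + j + 1ℤ) * (c k j * A k j)  ≡⟨ x∙yz≈y∙xz (+ 2 * (+ 2 * + j + 1ℤ)) (c k j) (A k j) ⟩
  c k j * (+ 2 * (+ 2 * + j + 1ℤ) * A k j)  ≡⟨ cong (c k j *_) (A-sucʳ k j) ⟨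
  c k j * (+ suc (k ℕ.+ j) * A k (suc j))   ≡⟨ regroup (c k j) (+ suc (k ℕ.+ j)) (A k (suc j)) ⟩
  + suc (k ℕ.+ j) * c k j * A k (suc j)     ≡⟨ cong (_* A k (suc j)) (c-sucʳ k j) ⟨
  + suc j * c k (suc j) * A k (suc j)       ≡⟨ ℤ.*-assoc (+ suc j) (c k (suc j)) _ ⟩
  + suc j * (c k (suc j) * A k (suc j))     ∎)
  where
  open ≡-Reasoning
  regroup : ∀ x y z → x * (y * z) ≡ y * x * z
  regroup = solve-∀

k+j+1∣2[2k+1]B*B : ∀ k j → + suc (k ℕ.+ j) ∣ + 2 * (+ suc (k ℕ.+ k) * (B k * B j))
k+j+1∣2[2k+1]B*B k j = divides (c k j * A (suc k) j) (begin
  + 2 * (+ suc (k ℕ.+ k) * (B k * B j))          ≡⟨ cong (λ z → + 2 * (+ suc (k ℕ.+ k) * z)) (B*B≡c*A k j) ⟩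
  + 2 * (+ suc (k ℕ.+ k) * (c k j * A k j))      ≡⟨ regroup (+ k) (c k j) (A k j) ⟩
  c k j * (+ 2 * (+ 2 * + k + 1ℤ) * A k j)       ≡⟨ cong (c k j *_) (A-sucˡ k j) ⟨
  c k j * (+ suc (k ℕ.+ j) * A (suc k) j)        ≡⟨ rotate (c k j) (+ suc (k ℕ.+ j)) (A (suc k) j) ⟩
  c k j * A (suc k) j * + suc (k ℕ.+ j)          ∎)
  where
  open ≡-Reasoning
  regroup : ∀ k x y → + 2 * ((1ℤ + (k + k)) * (x * y)) ≡ x * (+ 2 * (+ 2 * k + 1ℤ) * y)
  regroup = solve-∀
  rotate : ∀ x y z → x * (y * z) ≡ x * z * y
  rotate = solve-∀

-- Products and signs

∏ : (ℕ → ℤ) → ℕ → ℤ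
∏ w zero    = 1ℤ
∏ w (suc n) = w (suc n) * ∏ w n

∏-nonZero : ∀ {w} → (∀ i → NonZero (w (suc i))) → ∀ n → NonZero (∏ w n)
∏-nonZero nz zero    = _
∏-nonZero {w} nz (suc n) = ℤ.i*j≢0 (w (suc n)) (∏ w n) {{nz n}} {{∏-nonZero nz n}}

-- Here `∏ w n` is n! xⁿ, and the powers of x agree on both sides. The case x = 1 is about
-- factorials, the case x = p about products of multiples of p.
c-∏ : ∀ {w} x → (∀ i → w i ≡ + i * x) → ∀ a b → c a b * (∏ w a * ∏ w b) ≡ ∏ w (a ℕ.+ b)
c-∏ {w} x w≡ zero    b = trans (ℤ.*-identityˡ _) (ℤ.*-identityˡ (∏ w b))
c-∏ {w} x w≡ (suc a) b = begin
  c (suc a) b * (w (suc a) * ∏ w a * ∏ w b)             ≡⟨ cong (λ z → c (suc a) b * (z * ∏ w a * ∏ w b)) (w≡ (suc a)) ⟩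
  c (suc a) b * (+ suc a * x * ∏ w a * ∏ w b)           ≡⟨ group (c (suc a) b) (+ suc a) x (∏ w a) (∏ w b) ⟩
  + suc a * c (suc a) b * (x * (∏ w a * ∏ w b))         ≡⟨ cong (_* (x * (∏ w a * ∏ w b))) (c-sucˡ a b) ⟩
  + suc (a ℕ.+ b) * c a b * (x * (∏ w a * ∏ w b))       ≡⟨ regroup (+ suc (a ℕ.+ b)) (c a b) x (∏ w a * ∏ w b) ⟩
  + suc (a ℕ.+ b) * x * (c a b * (∏ w a * ∏ w b))       ≡⟨ cong₂ _*_ (sym (w≡ (suc (a ℕ.+ b)))) (c-∏ x w≡ a b) ⟩
  w (suc (a ℕ.+ b)) * ∏ w (a ℕ.+ b)                     ∎
  where
  open ≡-Reasoning
  group : ∀ c s x u v → c * (s * x * u * v) ≡ s * c * (x * (u * v))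
  group = solve-∀
  regroup : ∀ s c x y → s * c * (x * y) ≡ s * x * (c * y)
  regroup = solve-∀

∏-const : ∀ x n → ∏ (λ _ → x) n ≡ x ^ n
∏-const x zero    = refl
∏-const x (suc n) = cong (x *_) (∏-const x n)

-1^n*-1^n≡1 : ∀ n → -1ℤ ^ n * -1ℤ ^ n ≡ 1ℤ
-1^n*-1^n≡1 zero    = refl
-1^n*-1^n≡1 (suc n) = trans (square (-1ℤ ^ n)) (-1^n*-1^n≡1 n)
  where
  square : ∀ x → -1ℤ * x * (-1ℤ * x) ≡ x * x
  square = solve-∀

-- Discarding divisible terms from an antidiagonal sum

∣-D : ∀ {d f} n → (∀ k j → k ℕ.+ j ≡ n → d ∣ f k j) → d ∣ D f n
∣-D zero    d∣f = d∣f 0 0 refl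
∣-D (suc n) d∣f = ℤ.∣m∣n⇒∣m+n (d∣f 0 (suc n) refl)
  (∣-D n λ k j k+j≡n → d∣f (suc k) j (cong suc k+j≡n))

-- What remains is again an antidiagonal sum, of the shifted function, so that successive skips can
-- be chained.
∣-skip : ∀ {d f} b n → (∀ k j → k ℕ.< b → k ℕ.+ j ≡ b ℕ.+ n → d ∣ f k j) →
  d ∣ D f (b ℕ.+ n) - D (λ k → f (b ℕ.+ k)) n
∣-skip {d} {f} zero    n d∣f = divides 0ℤ (vanish (D f n) d)
  where
  vanish : ∀ x y → x - x ≡ 0ℤ * y
  vanish = solve-∀
∣-skip {d} {f} (suc b) n d∣f = subst (d ∣_) (sym (ℤ.+-assoc (f 0 (suc (b ℕ.+ n))) _ _))
  (ℤ.∣m∣n⇒∣m+n (d∣f 0 (suc (b ℕ.+ n)) (ℕ.s≤s ℕ.z≤n) refl)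
    (∣-skip b n λ k j k<b k+j≡b+n → d∣f (suc k) j (ℕ.s≤s k<b) (cong suc k+j≡b+n)))

∣-tail : ∀ {d f} n → (∀ k j → suc k ℕ.+ j ≡ n → d ∣ f (suc k) j) → d ∣ D f n - f 0 n
∣-tail {d} {f} zero d∣f = divides 0ℤ (vanish (f 0 0) d)
  where
  vanish : ∀ x y → x - x ≡ 0ℤ * y
  vanish = solve-∀
∣-tail {d} {f} (suc n) d∣f = subst (d ∣_) (cancel (f 0 (suc n)) _)
  (∣-D n λ k j k+j≡n → d∣f k j (cong suc k+j≡n))
  where
  cancel : ∀ x y → y ≡ x + y - x
  cancel = solve-∀

-- Residues modulo an odd prime

module OddPrime (h : ℕ) (p-prime : Prime (suc (h ℕ.+ h))) where

  p : ℕ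
  p = suc (h ℕ.+ h)

  suc∤ : ∀ {b} → suc b ℕ.≤ h ℕ.+ h → ¬ p ℕ.∣ suc b
  suc∤ b<2h = ℕ.>⇒∤ (ℕ.s≤s b<2h)

  -- With 1 in place of the factors at multiples of p, `∏ (strip w)` is the product over the indices
  -- prime to p, and no reindexing is necessary.
  strip : (ℕ → ℤ) → ℕ → ℤ
  strip w i with p ℕ.∣? i
  ... | yes _ = 1ℤ
  ... | no _  = w i

  strip-∣ : ∀ w {i} → p ℕ.∣ i → strip w i ≡ 1ℤ
  strip-∣ w {i} p∣i with p ℕ.∣? i
  ... | yes _   = refl
  ... | no p∤i  = contradiction p∣i p∤i

  strip-∤ : ∀ w {i} → ¬ p ℕ.∣ i → strip w i ≡ w i
  strip-∤ w {i} p∤i with p ℕ.∣? i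
  ... | yes p∣i = contradiction p∣i p∤i
  ... | no _    = refl

  -- Since b < p, the multiples of p up to b + a p are exactly p, 2p, ..., a p. For w i = i this is
  -- the splitting of a factorial into its part prime to p and the product of those multiples.
  ∏-split : ∀ w a b → b ℕ.≤ h ℕ.+ h →
    ∏ w (b ℕ.+ a ℕ.* p) ≡ ∏ (strip w) (b ℕ.+ a ℕ.* p) * ∏ (λ i → w (i ℕ.* p)) a
  ∏-split w zero    zero    _ = refl
  -- The predecessor of (a+1)p has quotient a and the largest residue, `h ℕ.+ h`.
  ∏-split w (suc a) zero    _ = begin
    w (p ℕ.+ a ℕ.* p) * ∏ w n                        ≡⟨ cong (w (p ℕ.+ a ℕ.* p) *_) (∏-split w a (h ℕ.+ h) ℕ.≤-refl) ⟩
    w (p ℕ.+ a ℕ.* p) * (∏ (strip w) n * ∏ (λ i → w (i ℕ.* p)) a)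
                                                     ≡⟨ rearrange (w (p ℕ.+ a ℕ.* p)) (∏ (strip w) n) _ ⟩
    1ℤ * ∏ (strip w) n * (w (p ℕ.+ a ℕ.* p) * ∏ (λ i → w (i ℕ.* p)) a)
                                                     ≡⟨ cong (λ z → z * ∏ (strip w) n * (w (p ℕ.+ a ℕ.* p) * ∏ (λ i → w (i ℕ.* p)) a)) (strip-∣ w (ℕ.n∣m*n (suc a))) ⟨
    strip w (p ℕ.+ a ℕ.* p) * ∏ (strip w) n * (w (p ℕ.+ a ℕ.* p) * ∏ (λ i → w (i ℕ.* p)) a) ∎
    where
    open ≡-Reasoning
    n = h ℕ.+ h ℕ.+ a ℕ.* p
    rearrange : ∀ x y z → x * (y * z) ≡ 1ℤ * y * (x * z)
    rearrange = solve-∀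
  ∏-split w a       (suc b) b<2h = begin
    w i * ∏ w (b ℕ.+ a ℕ.* p)      ≡⟨ cong₂ _*_ (strip-∤ w p∤i) (sym (∏-split w a b (ℕ.<⇒≤ b<2h))) ⟨
    strip w i * (∏ (strip w) (b ℕ.+ a ℕ.* p) * ∏ (λ i → w (i ℕ.* p)) a)
                                   ≡⟨ ℤ.*-assoc (strip w i) _ _ ⟨
    strip w i * ∏ (strip w) (b ℕ.+ a ℕ.* p) * ∏ (λ i → w (i ℕ.* p)) a ∎
    where
    open ≡-Reasoning
    i = suc b ℕ.+ a ℕ.* p
    p∤i : ¬ p ℕ.∣ i
    p∤i p∣i = suc∤ b<2h (ℕ.∣m+n∣m⇒∣n (subst (p ℕ.∣_) (ℕ.+-comm (suc b) (a ℕ.* p)) p∣i) (ℕ.n∣m*n a))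

  -- The index k for which 2k + 1 is the odd multiple (2a+1)p.
  centre : ℕ → ℕ
  centre a = h ℕ.+ a ℕ.* p

  -- The residue of the sum is p - 1, the largest one. Hence `∏-split` applies to it with quotient a
  -- + b, and its successor is (a+b+1)p.
  centre+centre : ∀ a b → centre a ℕ.+ centre b ≡ h ℕ.+ h ℕ.+ (a ℕ.+ b) ℕ.* p
  centre+centre a b = eq h a b p
    where
    eq : ∀ h a b p → h ℕ.+ a ℕ.* p ℕ.+ (h ℕ.+ b ℕ.* p) ≡ h ℕ.+ h ℕ.+ (a ℕ.+ b) ℕ.* p
    eq = ℕ.solve-∀

  F : ℕ → ℤ
  F = ∏ (strip (+_))

  -- Each of k!, j! and (k+j)! splits into `F` and a product of multiples of p; by `c-∏` with x = p,
  -- the latter products make up C(a+b,a).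
  F*F*c : ∀ a b → let k = centre a; j = centre b in F k * F j * c k j ≡ F (k ℕ.+ j) * c a b
  F*F*c a b = ℤ.*-cancelʳ-≡ _ _ (Q a * Q b) (begin
    F k * F j * c k j * (Q a * Q b)         ≡⟨ group (F k) (F j) (c k j) (Q a) (Q b) ⟩
    c k j * ((F k * Q a) * (F j * Q b))     ≡⟨ cong₂ (λ x y → c k j * (x * y)) (∏-split (+_) a h (ℕ.m≤m+n h h)) (∏-split (+_) b h (ℕ.m≤m+n h h)) ⟨
    c k j * (∏ (+_) k * ∏ (+_) j)               ≡⟨ c-∏ 1ℤ (λ i → sym (ℤ.*-identityʳ (+ i))) k j ⟩
    ∏ (+_) (k ℕ.+ j)                          ≡⟨ cong (∏ (+_)) (centre+centre a b) ⟩
    ∏ (+_) n                                  ≡⟨ ∏-split (+_) (a ℕ.+ b) (h ℕ.+ h) ℕ.≤-refl ⟩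
    F n * Q (a ℕ.+ b)                       ≡⟨ cong₂ (λ x y → F x * y) (centre+centre a b) (c-∏ (+ p) (λ i → ℤ.pos-* i p) a b) ⟨
    F (k ℕ.+ j) * (c a b * (Q a * Q b))     ≡⟨ ℤ.*-assoc (F (k ℕ.+ j)) (c a b) _ ⟨
    F (k ℕ.+ j) * c a b * (Q a * Q b)       ∎)
    where
    open ≡-Reasoning
    k = centre a
    j = centre b
    n = h ℕ.+ h ℕ.+ (a ℕ.+ b) ℕ.* p
    Q = ∏ (λ i → + (i ℕ.* p))
    instance
      Q*Q≢0 : NonZero (Q a * Q b)
      Q*Q≢0 = ℤ.i*j≢0 (Q a) (Q b) {{∏-nonZero _ a}} {{∏-nonZero _ b}}
    group : ∀ x y c u v → x * y * c * (u * v) ≡ c * ((x * u) * (y * v))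
    group = solve-∀

  -- The sign (-1)ᵉ, where e counts the positive indices up to the argument that are prime to p.
  σ : ℕ → ℤ
  σ = ∏ (strip (λ _ → -1ℤ))

  ε : ℤ
  ε = -1ℤ ^ h

  -- Of the h + a p indices, a are multiples of p, and h + a p - a = h + 2ha has the parity of h.
  σ-centre : ∀ a → σ (centre a) ≡ ε
  σ-centre a = begin
    σ (centre a)                                ≡⟨ ℤ.*-identityʳ _ ⟨
    σ (centre a) * 1ℤ                           ≡⟨ cong (σ (centre a) *_) (-1^n*-1^n≡1 a) ⟨
    σ (centre a) * (-1ℤ ^ a * -1ℤ ^ a)          ≡⟨ ℤ.*-assoc (σ (centre a)) _ _ ⟨
    σ (centre a) * -1ℤ ^ a * -1ℤ ^ a            ≡⟨ cong (λ z → σ (centre a) * z * -1ℤ ^ a) (∏-const -1ℤ a) ⟨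
    σ (centre a) * ∏ (λ _ → -1ℤ) a * -1ℤ ^ a    ≡⟨ cong (_* -1ℤ ^ a) (∏-split (λ _ → -1ℤ) a h (ℕ.m≤m+n h h)) ⟨
    ∏ (λ _ → -1ℤ) (centre a) * -1ℤ ^ a          ≡⟨ cong (_* -1ℤ ^ a) (∏-const -1ℤ (centre a)) ⟩
    -1ℤ ^ (h ℕ.+ a ℕ.* p) * -1ℤ ^ a             ≡⟨ cong (_* -1ℤ ^ a) (ℤ.^-distribˡ-+-* -1ℤ h (a ℕ.* p)) ⟩
    ε * -1ℤ ^ (a ℕ.* p) * -1ℤ ^ a               ≡⟨ cong (λ z → ε * z * -1ℤ ^ a) -1^ap ⟩
    ε * -1ℤ ^ a * -1ℤ ^ a                       ≡⟨ ℤ.*-assoc ε _ _ ⟩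
    ε * (-1ℤ ^ a * -1ℤ ^ a)                     ≡⟨ cong (ε *_) (-1^n*-1^n≡1 a) ⟩
    ε * 1ℤ                                      ≡⟨ ℤ.*-identityʳ ε ⟩
    ε                                           ∎
    where
    open ≡-Reasoning
    -1^ap : -1ℤ ^ (a ℕ.* p) ≡ -1ℤ ^ a
    -1^ap = begin
      -1ℤ ^ (a ℕ.* p)                ≡⟨ cong (-1ℤ ^_) (ℕ.*-comm a p) ⟩
      -1ℤ ^ (p ℕ.* a)                ≡⟨ ℤ.^-*-assoc -1ℤ p a ⟨
      (-1ℤ * -1ℤ ^ (h ℕ.+ h)) ^ a    ≡⟨ cong (λ z → (-1ℤ * z) ^ a) (trans (ℤ.^-distribˡ-+-* -1ℤ h h) (-1^n*-1^n≡1 h)) ⟩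
      -1ℤ ^ a                        ∎

  -- Pairing i with a + b + 1 - i for i ≤ b.
  F-reflection : ∀ a b → p ℕ.∣ suc (a ℕ.+ b) → + suc (a ℕ.+ b) ∣ F (a ℕ.+ b) - σ b * (F a * F b)
  F-reflection a zero p∣ = divides 0ℤ
    (trans (cong (λ z → F z - 1ℤ * (F a * 1ℤ)) (ℕ.+-identityʳ a)) (vanish (F a) (+ suc (a ℕ.+ 0))))
    where
    vanish : ∀ x y → x - 1ℤ * (x * 1ℤ) ≡ 0ℤ * y
    vanish = solve-∀
  F-reflection a (suc b) p∣ rewrite ℕ.+-suc a b with p ℕ.∣? suc b
  -- The paired indices a + 1 and b + 1 add up to a multiple of p, so both are stripped.
  ... | yes p∣b = subst (λ z → + suc n ∣ F n - z) (begin
      σ b * (strip (+_) (suc a) * F a * F b)     ≡⟨ cong (λ z → σ b * (z * F a * F b)) (strip-∣ (+_) p∣a) ⟩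
      σ b * (1ℤ * F a * F b)                   ≡⟨ units (σ b) (F a) (F b) ⟩
      1ℤ * σ b * (F a * (1ℤ * F b))            ∎)
      (F-reflection (suc a) b p∣)
    where
    open ≡-Reasoning
    n = suc (a ℕ.+ b)
    p∣a : p ℕ.∣ suc a
    p∣a = ℕ.∣m+n∣m⇒∣n (subst (p ℕ.∣_) (trans (cong suc (sym (ℕ.+-suc a b))) (ℕ.+-comm (suc a) (suc b))) p∣) p∣b
    units : ∀ s x y → s * (1ℤ * x * y) ≡ 1ℤ * s * (x * (1ℤ * y))
    units = solve-∀
  -- Here neither is stripped. Their sum is the modulus, so a + 1 may be replaced by -(b + 1), which
  -- accounts for the new sign in `σ`.
  ... | no p∤b = subst (+ suc n ∣_) (begin
      F n - σ b * (strip (+_) (suc a) * F a * F b) + σ b * (F a * F b) * + suc n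
        ≡⟨ cong (λ z → F n - σ b * (z * F a * F b) + σ b * (F a * F b) * + suc n) (strip-∤ (+_) p∤a) ⟩
      F n - σ b * (+ suc a * F a * F b) + σ b * (F a * F b) * + suc n
        ≡⟨ collect (+ a) (+ b) (F n) (σ b) (F a) (F b) ⟩
      F n - -1ℤ * σ b * (F a * (+ suc b * F b)) ∎)
      (ℤ.∣m∣n⇒∣m+n (F-reflection (suc a) b p∣) (ℤ.∣n⇒∣m*n (σ b * (F a * F b)) ℤ.∣-refl))
    where
    open ≡-Reasoning
    n = suc (a ℕ.+ b)
    p∤a : ¬ p ℕ.∣ suc a
    p∤a p∣a = p∤b (ℕ.∣m+n∣m⇒∣n (subst (p ℕ.∣_) (cong suc (sym (ℕ.+-suc a b))) p∣) p∣a)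
    collect : ∀ a b X s x y → X - s * ((1ℤ + a) * x * y) + s * (x * y) * (1ℤ + (1ℤ + (a + b)))
      ≡ X - -1ℤ * s * (x * ((1ℤ + b) * y))
    collect = solve-∀

  -- Reduction of the sum to the centres

  below-centre : ∀ {k} → k ℕ.< h → ¬ p ℕ.∣ suc (k ℕ.+ k)
  below-centre {k} k<h = suc∤ (ℕ.+-mono-≤-< (ℕ.<⇒≤ k<h) k<h)

  -- For the index h + k + 1 the odd number is p + 2(k+1), and 0 < 2(k+1) < p.
  above-centre : ∀ {k} → k ℕ.< h → ¬ p ℕ.∣ suc (h ℕ.+ suc k ℕ.+ (h ℕ.+ suc k))
  above-centre {k} k<h p∣ = suc∤ (subst (ℕ._≤ h ℕ.+ h) (ℕ.+-suc (suc k) k) (ℕ.+-mono-≤ k<h k<h))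
    (ℕ.∣m+n∣m⇒∣n (subst (p ℕ.∣_) (eq h k) p∣) ℕ.∣-refl)
    where
    eq : ∀ h k → suc (h ℕ.+ suc k ℕ.+ (h ℕ.+ suc k)) ≡ suc (h ℕ.+ h) ℕ.+ suc (suc (k ℕ.+ k))
    eq = ℕ.solve-∀

  -- p ∣ 2k + 1 exactly when k = h + a p for some a.
  ∣-centres : ∀ {d} f l → (∀ k j → k ℕ.+ j ≡ h ℕ.+ h ℕ.+ l ℕ.* p → ¬ p ℕ.∣ suc (k ℕ.+ k) → d ∣ f k j) →
    d ∣ D f (h ℕ.+ h ℕ.+ l ℕ.* p) - D (λ a b → f (centre a) (centre b)) l
  ∣-centres {d} f zero d∣f = subst (d ∣_) eq
    (ℤ.∣m∣n⇒∣m+n (∣-skip h h λ k j k<h k+j≡ → d∣f k j (trans k+j≡ (sym (ℕ.+-identityʳ _))) (below-centre k<h))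
                  (∣-tail h λ k j k+j≡h → d∣f (h ℕ.+ suc k) j
                    (trans (ℕ.+-assoc h (suc k) j) (trans (cong (h ℕ.+_) k+j≡h) (sym (ℕ.+-identityʳ _))))
                    (above-centre (ℕ.m+n≤o⇒m≤o (suc k) (ℕ.≤-reflexive k+j≡h)))))
    where
    g = λ k → f (h ℕ.+ k)
    telescope : ∀ x y z → x - y + (y - z) ≡ x - z
    telescope = solve-∀
    eq : D f (h ℕ.+ h) - D g h + (D g h - g 0 h) ≡ D f (h ℕ.+ h ℕ.+ 0) - f (h ℕ.+ 0) (h ℕ.+ 0)
    eq = trans (telescope (D f (h ℕ.+ h)) (D g h) (g 0 h))
      (cong₂ (λ m n → D f m - f (h ℕ.+ 0) n) (sym (ℕ.+-identityʳ (h ℕ.+ h))) (sym (ℕ.+-identityʳ h)))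
  -- Skip the h terms before the first centre, keep the centre, skip the h terms after it. The rest
  -- starts at k = p and is the same sum for `f′`, with one block fewer.
  ∣-centres {d} f (suc l) d∣f = subst (d ∣_) eq (ℤ.∣m∣n⇒∣m+n (ℤ.∣m∣n⇒∣m+n
      (∣-skip h (suc (h ℕ.+ M)) λ k j k<h k+j≡ → d∣f k j (trans k+j≡ (sym N≡)) (below-centre k<h))
      (∣-skip h M λ k j k<h k+j≡ → d∣f (h ℕ.+ suc k) j
        (trans (ℕ.+-assoc h (suc k) j) (trans (cong (λ z → h ℕ.+ suc z) k+j≡) (sym N≡))) (above-centre k<h)))
      (∣-centres f′ l λ k j k+j≡ p∤ → d∣f (h ℕ.+ suc (h ℕ.+ k)) j
        (trans (ℕ.+-assoc h (suc (h ℕ.+ k)) j)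
          (trans (cong (λ z → h ℕ.+ suc z) (trans (ℕ.+-assoc h k j) (cong (h ℕ.+_) k+j≡))) (sym N≡)))
        -- Shifting k by p adds 2p to 2k + 1.
        (λ p∣ → p∤ (ℕ.∣m+n∣m⇒∣n (subst (p ℕ.∣_) (shift-odd h k) p∣) (ℕ.m∣m*n 2)))))
    where
    M = h ℕ.+ h ℕ.+ l ℕ.* p
    f′ = λ k → f (h ℕ.+ suc (h ℕ.+ k))
    N≡ : h ℕ.+ h ℕ.+ suc l ℕ.* p ≡ h ℕ.+ suc (h ℕ.+ M)
    N≡ = shift h (l ℕ.* p)
      where
      shift : ∀ h x → h ℕ.+ h ℕ.+ (suc (h ℕ.+ h) ℕ.+ x) ≡ h ℕ.+ suc (h ℕ.+ (h ℕ.+ h ℕ.+ x))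
      shift = ℕ.solve-∀
    shift-odd : ∀ h k → suc (h ℕ.+ suc (h ℕ.+ k) ℕ.+ (h ℕ.+ suc (h ℕ.+ k))) ≡ suc (h ℕ.+ h) ℕ.* 2 ℕ.+ suc (k ℕ.+ k)
    shift-odd = ℕ.solve-∀
    centre-shift : ∀ h x → h ℕ.+ suc (h ℕ.+ (h ℕ.+ x)) ≡ h ℕ.+ (suc (h ℕ.+ h) ℕ.+ x)
    centre-shift = ℕ.solve-∀
    telescope : ∀ x y z w v → x - (y + z) + (z - w) + (w - v) ≡ x - (y + v)
    telescope = solve-∀
    g₁ = λ k → f (h ℕ.+ suc k)
    eq : D f (h ℕ.+ suc (h ℕ.+ M)) - (f (h ℕ.+ 0) (suc (h ℕ.+ M)) + D g₁ (h ℕ.+ M))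
         + (D g₁ (h ℕ.+ M) - D f′ M) + (D f′ M - D (λ a b → f′ (centre a) (centre b)) l)
       ≡ D f (h ℕ.+ h ℕ.+ suc l ℕ.* p) - D (λ a b → f (centre a) (centre b)) (suc l)
    eq = trans (telescope (D f (h ℕ.+ suc (h ℕ.+ M))) (f (h ℕ.+ 0) (suc (h ℕ.+ M))) (D g₁ (h ℕ.+ M)) (D f′ M) _)
      (cong₂ _-_ (cong (D f) (sym N≡)) (cong₂ _+_
        (cong (f (h ℕ.+ 0)) (suc-centre h (l ℕ.* p)))
        (D-cong l λ a b _ → cong (λ k → f k (centre b)) (centre-shift h (a ℕ.* p)))))
      where
      suc-centre : ∀ h x → suc (h ℕ.+ (h ℕ.+ h ℕ.+ x)) ≡ h ℕ.+ (suc (h ℕ.+ h) ℕ.+ x)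
      suc-centre = ℕ.solve-∀

  -- Cancellation modulo a power of p

  cancel-p∤ : ∀ r {i x} → ¬ p ℕ.∣ i → + (p ℕ.^ r) ∣ + i * x → + (p ℕ.^ r) ∣ x
  cancel-p∤ zero    {x = x} p∤i _ = divides x (sym (ℤ.*-identityʳ x))
  cancel-p∤ (suc r) {i} {x} p∤i d∣ix with euclidsLemma i ∣ x ∣ p-prime
      (subst (p ℕ.∣_) (ℤ.abs-* (+ i) x) (ℕ.∣-trans (ℕ.m∣m*n (p ℕ.^ r)) (ℤ.∣⇒∣ᵤ d∣ix)))
  ... | inj₁ p∣i = contradiction p∣i p∤i
  -- With x = y p, one factor p is removed from the modulus and from the product, and the induction
  -- continues with y.
  ... | inj₂ p∣x with divides y refl ← ℤ.∣ᵤ⇒∣ {+ p} {x} p∣x = subst (_∣ y * + p) (trans (ℤ.*-comm (+ (p ℕ.^ r)) (+ p)) (sym (ℤ.pos-* p (p ℕ.^ r))))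
    (ℤ.*-monoˡ-∣ (+ p) (cancel-p∤ r p∤i (ℤ.*-cancelʳ-∣ (+ p)
      (subst₂ _∣_ (trans (ℤ.pos-* p (p ℕ.^ r)) (ℤ.*-comm (+ p) _)) (sym (ℤ.*-assoc (+ i) y (+ p))) d∣ix))))

  cancel-F : ∀ r k {x} → + (p ℕ.^ r) ∣ F k * x → + (p ℕ.^ r) ∣ x
  cancel-F r zero    {x} d∣ = subst (+ (p ℕ.^ r) ∣_) (ℤ.*-identityˡ x) d∣
  cancel-F r (suc k) {x} d∣ with p ℕ.∣? suc k
  ... | yes _  = cancel-F r k (subst (λ z → + (p ℕ.^ r) ∣ z * x) (ℤ.*-identityˡ (F k)) d∣)
  ... | no p∤k = cancel-F r k (cancel-p∤ r p∤k (subst (+ (p ℕ.^ r) ∣_) (ℤ.*-assoc (+ suc k) (F k) x) d∣))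

  cancel-2 : ∀ r {x} → + (p ℕ.^ r) ∣ + 2 * x → + (p ℕ.^ r) ∣ x
  cancel-2 r = cancel-p∤ r (suc∤ (ℕ.+-mono-≤ (1≤h h p-prime) (1≤h h p-prime)))
    where
    -- Primality excludes p = 1, so p is at least 3 and cannot divide 2.
    1≤h : ∀ h → Prime (suc (h ℕ.+ h)) → 1 ℕ.≤ h
    1≤h zero    prime[1] = contradiction prime[1] ¬prime[1]
    1≤h (suc _) _        = ℕ.s≤s ℕ.z≤n

  -- The terms modulo a power of p

  t-off-centre : ∀ r k j → + (p ℕ.^ r) ∣ + suc (k ℕ.+ j) → ¬ p ℕ.∣ suc (k ℕ.+ k) → + (p ℕ.^ r) ∣ t k j
  t-off-centre r k j d∣n p∤ = subst (+ (p ℕ.^ r) ∣_) (sym (ℤ.*-assoc (c k j) (B k) (B j)))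
    (ℤ.∣n⇒∣m*n (c k j) (cancel-p∤ r p∤ (cancel-2 r (ℤ.∣-trans d∣n (k+j+1∣2[2k+1]B*B k j)))))

  +suc[centre+centre] : ∀ a b → + suc (centre a ℕ.+ centre b) ≡ + suc (a ℕ.+ b) * + p
  +suc[centre+centre] a b = trans (cong (λ z → + suc z) (centre+centre a b)) (ℤ.pos-* (suc (a ℕ.+ b)) p)

  p∣suc[centre+centre] : ∀ a b → p ℕ.∣ suc (centre a ℕ.+ centre b)
  p∣suc[centre+centre] a b = ℕ.divides (suc (a ℕ.+ b)) (cong suc (centre+centre a b))

  lift-∣ : ∀ r {x} → + (p ℕ.^ r) ∣ x → + (p ℕ.^ suc r) ∣ x * + p
  lift-∣ r {x} d∣x = subst (_∣ x * + p)
    (trans (ℤ.*-comm (+ (p ℕ.^ r)) (+ p)) (sym (ℤ.pos-* p (p ℕ.^ r)))) (ℤ.*-monoˡ-∣ (+ p) d∣x)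

  -- At k = `centre a` the number 2k + 1 is (2a+1)p. The factor p gives one power, and the other r
  -- come from a + b + 1, which divides 2(2a+1) B(a) B(b).
  ∣[2k+1]*t : ∀ r a b → + (p ℕ.^ r) ∣ + suc (a ℕ.+ b) →
    + (p ℕ.^ suc r) ∣ + suc (centre a ℕ.+ centre a) * t a b
  ∣[2k+1]*t r a b d∣n = subst (+ (p ℕ.^ suc r) ∣_) eq
    (ℤ.∣n⇒∣m*n (c a b) (cancel-2 (suc r) (subst (+ (p ℕ.^ suc r) ∣_) (ℤ.*-assoc (+ 2) (+ suc (a ℕ.+ a) * (B a * B b)) (+ p))
      (lift-∣ r (ℤ.∣-trans d∣n (k+j+1∣2[2k+1]B*B a b))))))
    where
    group : ∀ c s x y p → c * (s * (x * y) * p) ≡ s * p * (c * x * y)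
    group = solve-∀
    eq : c a b * (+ suc (a ℕ.+ a) * (B a * B b) * + p) ≡ + suc (centre a ℕ.+ centre a) * t a b
    eq = trans (group (c a b) (+ suc (a ℕ.+ a)) (B a) (B b) (+ p))
      (cong (_* t a b) (sym (+suc[centre+centre] a a)))

  -- The reflection holds modulo k + j + 1, which d need not divide; the factor x supplies what is
  -- missing.
  reflect-centres : ∀ {d x} a b → let k = centre a; j = centre b in
    d ∣ + suc (k ℕ.+ j) * x → d ∣ (F (k ℕ.+ j) - ε * (F k * F j)) * x
  reflect-centres {d} {x} a b d∣ with divides q eq ← F-reflection (centre a) (centre b) (p∣suc[centre+centre] a b)
    = subst (d ∣_) (trans (sym (ℤ.*-assoc q _ x))
        (cong (_* x) (trans (sym eq) (cong (λ s → F (centre a ℕ.+ centre b) - s * (F (centre a) * F (centre b))) (σ-centre b)))))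
        (ℤ.∣n⇒∣m*n q d∣)

  t-centre : ∀ r a b → + (p ℕ.^ r) ∣ + suc (a ℕ.+ b) →
    + (p ℕ.^ suc r) ∣ t (centre a) (centre b) - ε * t a b
  t-centre r a b d∣n = cancel-F (suc r) j (cancel-F (suc r) j (cancel-F (suc r) k
      (cancel-F (suc r) k (cancel-F (suc r) j (cancel-F (suc r) k (subst (d ∣_) eq
        -- `X`, `Y`, `Z` are exchanged one after the other for `ε * u`, `ε * v`, `ε * w`. The last
        -- coefficient is `u * v` instead of ε² u v, which is the same because ε² = 1, and the total
        -- sign ε³ becomes ε.
        (ℤ.∣m∣n⇒∣m+n (ℤ.∣m∣n⇒∣m+n (ℤ.∣n⇒∣m*n (Y * Z) first) (ℤ.∣n⇒∣m*n (ε * u * Z) second))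
          (ℤ.∣n⇒∣m*n (u * v) third))))))))
    where
    open ≡-Reasoning
    k j : ℕ
    k = centre a
    j = centre b
    d u v w X Y Z : ℤ
    d = + (p ℕ.^ suc r)
    u = F k * F j
    v = F k * F k
    w = F j * F j
    X = F (k ℕ.+ j)
    Y = F (k ℕ.+ k)
    Z = F (j ℕ.+ j)
    first : d ∣ (X - ε * u) * t a b
    first = reflect-centres a b (ℤ.∣m⇒∣m*n (t a b)
      (subst (d ∣_) (sym (+suc[centre+centre] a b)) (lift-∣ r d∣n)))
    second : d ∣ (Y - ε * v) * t a b
    second = reflect-centres a a (∣[2k+1]*t r a b d∣n)
    third : d ∣ (Z - ε * w) * t a b
    -- `∣[2k+1]*t` concerns the first index, so a and b are exchanged by symmetry of `t`.
    third = reflect-centres b b (subst (λ z → d ∣ + suc (j ℕ.+ j) * z) (t-sym b a)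
      (∣[2k+1]*t r b a (subst (λ z → + (p ℕ.^ r) ∣ + suc z) (ℕ.+-comm a b) d∣n)))
    expand : ∀ X Y Z u v w e τ → Y * Z * ((X - e * u) * τ) + e * u * Z * ((Y - e * v) * τ) + u * v * ((Z - e * w) * τ)
      ≡ X * Y * Z * τ - e * (u * v * w) * τ + (1ℤ - e * e) * (u * v * Z * τ)
    expand = solve-∀
    vanish : ∀ x y → x + (1ℤ - 1ℤ) * y ≡ x
    vanish = solve-∀
    interleave : ∀ X Y Z x y z → X * Y * Z * (x * y * z) ≡ X * x * (Y * y) * (Z * z)
    interleave = solve-∀
    regroup : ∀ f g x y z e τ → f * g * x * (f * f * y) * (g * g * z) - e * (f * g * (f * f) * (g * g)) * τ
      ≡ f * (g * (f * (f * (g * (g * (x * y * z - e * τ))))))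
    regroup = solve-∀
    eq : Y * Z * ((X - ε * u) * t a b) + ε * u * Z * ((Y - ε * v) * t a b) + u * v * ((Z - ε * w) * t a b)
       ≡ F k * (F j * (F k * (F k * (F j * (F j * (t k j - ε * t a b))))))
    eq = begin
      Y * Z * ((X - ε * u) * t a b) + ε * u * Z * ((Y - ε * v) * t a b) + u * v * ((Z - ε * w) * t a b)
        ≡⟨ expand X Y Z u v w ε (t a b) ⟩
      X * Y * Z * t a b - ε * (u * v * w) * t a b + (1ℤ - ε * ε) * (u * v * Z * t a b)
        ≡⟨ cong (λ z → X * Y * Z * t a b - ε * (u * v * w) * t a b + (1ℤ - z) * (u * v * Z * t a b)) (-1^n*-1^n≡1 h) ⟩
      X * Y * Z * t a b - ε * (u * v * w) * t a b + (1ℤ - 1ℤ) * (u * v * Z * t a b)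
        ≡⟨ vanish _ (u * v * Z * t a b) ⟩
      X * Y * Z * t a b - ε * (u * v * w) * t a b
        ≡⟨ cong (_- ε * (u * v * w) * t a b) (interleave X Y Z (c a b) (B a) (B b)) ⟩
      X * c a b * (Y * B a) * (Z * B b) - ε * (u * v * w) * t a b
        ≡⟨ cong (_- ε * (u * v * w) * t a b) (cong₂ _*_ (cong₂ _*_ (F*F*c a b) (F*F*c a a)) (F*F*c b b)) ⟨
      u * c k j * (v * B k) * (w * B j) - ε * (u * v * w) * t a b
        ≡⟨ regroup (F k) (F j) (c k j) (B k) (B j) ε (t a b) ⟩
      F k * (F j * (F k * (F k * (F j * (F j * (t k j - ε * t a b)))))) ∎

  -- The successor of the upper index is (l+1)p, so the exponent rises by one. The terms off the
  -- centres drop out, and the centres match the terms of `m₀ l` one by one.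
  m₀-congruence : ∀ r l → + (p ℕ.^ r) ∣ + suc l →
    + (p ℕ.^ suc r) ∣ m₀ (h ℕ.+ h ℕ.+ l ℕ.* p) - ε * m₀ l
  m₀-congruence r l d∣n = subst (+ (p ℕ.^ suc r) ∣_) eq
    (ℤ.∣m∣n⇒∣m+n
      (∣-centres t l λ k j k+j≡ p∤ → t-off-centre (suc r) k j
        (subst (+ (p ℕ.^ suc r) ∣_) (sym (trans (cong (λ z → + suc z) k+j≡) (ℤ.pos-* (suc l) p))) (lift-∣ r d∣n)) p∤)
      (∣-D l λ { a b refl → t-centre r a b d∣n }))
    where
    open ≡-Reasoning
    N = h ℕ.+ h ℕ.+ l ℕ.* p
    T = D (λ a b → t (centre a) (centre b)) l
    split : ∀ x e y → x - e * y ≡ - e * y + x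
    split = solve-∀
    telescope : ∀ x y e z → x - y + (- e * z + y) ≡ x - e * z
    telescope = solve-∀
    eq : m₀ N - T + D (λ a b → t (centre a) (centre b) - ε * t a b) l ≡ m₀ N - ε * m₀ l
    eq = begin
      m₀ N - T + D (λ a b → t (centre a) (centre b) - ε * t a b) l
        ≡⟨ cong (λ z → m₀ N - T + z) (D-cong l λ a b _ → split (t (centre a) (centre b)) ε (t a b)) ⟩
      m₀ N - T + D (λ a b → - ε * t a b + t (centre a) (centre b)) l
        ≡⟨ cong (λ z → m₀ N - T + z) (D-linear (- ε) t _ l) ⟩
      m₀ N - T + (- ε * m₀ l + T)
        ≡⟨ telescope (m₀ N) T ε (m₀ l) ⟩
      m₀ N - ε * m₀ l ∎

-- From `m₀` back to the given sequence

odd⇒1+2h : ∀ {p} → ¬ 2 ℕ.∣ p → p ≡ suc (p / 2 ℕ.+ p / 2)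
odd⇒1+2h {p} 2∤p = begin
  p                       ≡⟨ ℕ.m≡m%n+[m/n]*n p 2 ⟩
  p % 2 ℕ.+ p / 2 ℕ.* 2   ≡⟨ cong₂ ℕ._+_ (%2≡1 (p % 2) refl (ℕ.m%n<n p 2)) (double (p / 2)) ⟩
  suc (p / 2 ℕ.+ p / 2)   ∎
  where
  open ≡-Reasoning
  double : ∀ h → h ℕ.* 2 ≡ h ℕ.+ h
  double = ℕ.solve-∀
  %2≡1 : ∀ i → p % 2 ≡ i → i ℕ.< 2 → i ≡ 1
  %2≡1 0 eq _ = contradiction (ℕ.m%n≡0⇒n∣m p 2 eq) 2∤p
  %2≡1 1 _  _ = refl
  %2≡1 (suc (suc _)) _ (ℕ.s≤s (ℕ.s≤s ()))

-- The equation for p is a hypothesis so that matching it with `refl` gives p the form required by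
-- `OddPrime`.
S-congruence : ∀ {S} → IsS S → ∀ h p → p ≡ suc (h ℕ.+ h) → Prime p → ∀ m r → 1 ℕ.≤ m →
  + (p ℕ.^ suc r) ∣ S (m ℕ.* p ℕ.^ suc r ℕ.∸ 1) - -1ℤ ^ ((p ℕ.∸ 1) / 2) * S (m ℕ.* p ℕ.^ r ℕ.∸ 1)
S-congruence {S} isS h p@.(suc (h ℕ.+ h)) refl p-prime m@(suc _) r _ =
  subst (+ (p ℕ.^ suc r) ∣_) eq (OddPrime.m₀-congruence h p-prime r l (ℤ.∣ᵤ⇒∣ (subst (p ℕ.^ r ℕ.∣_) (sym l≡) (ℕ.n∣m*n m))))
  where
  -- With l + 1 = m pʳ, the upper index 2h + l p equals (l+1)p - 1, the predecessor of m times the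
  -- next power of p.
  l = ℕ.pred (m ℕ.* p ℕ.^ r)
  instance _ = ℕ.m^n≢0 p r
  l≡ : suc l ≡ m ℕ.* p ℕ.^ r
  l≡ = ℕ.suc-pred (m ℕ.* p ℕ.^ r) {{ℕ.m*n≢0 m (p ℕ.^ r)}}
  half : h ≡ (h ℕ.+ h) / 2
  half = trans (sym (ℕ.m*n/n≡m h 2)) (cong (_/ 2) (double h))
    where
    double : ∀ h → h ℕ.* 2 ≡ h ℕ.+ h
    double = ℕ.solve-∀
  top : h ℕ.+ h ℕ.+ l ℕ.* p ≡ m ℕ.* p ℕ.^ suc r ℕ.∸ 1
  top = cong (ℕ._∸ 1) (trans (cong (ℕ._* p) l≡) (rotate m (p ℕ.^ r) p))
    where
    rotate : ∀ m q p → m ℕ.* q ℕ.* p ≡ m ℕ.* (p ℕ.* q)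
    rotate = ℕ.solve-∀
  eq : m₀ (h ℕ.+ h ℕ.+ l ℕ.* p) - -1ℤ ^ h * m₀ l
     ≡ S (m ℕ.* p ℕ.^ suc r ℕ.∸ 1) - -1ℤ ^ ((h ℕ.+ h) / 2) * S (m ℕ.* p ℕ.^ r ℕ.∸ 1)
  eq = cong₂ _-_ (trans (sym (S≡m₀ isS _)) (cong S top))
    (cong₂ _*_ (cong (-1ℤ ^_) half) (trans (sym (S≡m₀ isS l)) (cong (λ z → S (z ℕ.∸ 1)) l≡)))

theorem3p3 : (S : ℕ → ℤ) → IsS S →
    (p : ℕ) → Prime p → ¬ (2 ℕ.∣ p) →
    (m r : ℕ) → 1 ℕ.≤ m → 1 ℕ.≤ r →
    S (m ℕ.* p ℕ.^ r ℕ.∸ 1)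
    ≡ -1ℤ ^ ((p ℕ.∸ 1) / 2) * S (m ℕ.* p ℕ.^ (r ℕ.∸ 1) ℕ.∸ 1) [mod p ℕ.^ r ]
theorem3p3 S isS p p-prime 2∤p m (suc r) 1≤m _ =
  S-congruence isS (p / 2) p (odd⇒1+2h 2∤p) p-prime m r 1≤m
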